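{- Let $n\ge1$. (a) The $\bigsqcup$-irreducible elements of $\widehat{\mathcal F_n}$ and of $\mathcal F_n$ are the same, and the completely meet-irreducible elements of $\widehat{\mathcal F_n}$ and of $\mathcal F_n$ are the same. (b) Any element of $\widehat{\mathcal F_n}$ is a (possibly infinite) union as well as a (possibly infinite) intersection of elements of $\mathcal F_n$.
   Context: Fix $n\ge1$ and symbols $P_1,\dots,P_n$. The partially ordered set $(K_n,\le)$ with valuation map $\mathrm{val}:K_n\to\mathfrak P(\{P_1,\dots,P_n\})$ is the increasing union of finite sets $K_n^d$ ($d\ge 0$) built recursively: $K_n^{ -1}=\emptyset$, and $K_n^d\setminus K_n^{d-1}$ consists of exactly one point $w_{\beta,Y}$ for each pair $(\beta,Y)$ such that (i) $Y$ is a decreasing subset of $K_n^{d-1}$ with $Y\not\subseteq K_n^{d-2}$ (for $d=0$ this last condition is void, so $Y=\emptyset$); (ii) $\beta\subseteq\{P_1,\dots,P_n\}$ and $\beta\subseteq\mathrm{val}(w')$ for all $w'\in Y$; (iii) if $Y$ is the decreasing set generated by a single element $w_{\beta',Y'}$, then $\beta\ne\beta'$. One sets $\mathrm{val}(w_{\beta,Y})=\beta$, and $w\le w_{\beta,Y}$ iff $w\in Y$ or $w=w_{\beta,Y}$. $\widehat{\mathcal F_n}:=\mathcal O_\downarrow(K_n,\le)$ is the Heyting algebra of all decreasing subsets of $K_n$ ($\sqcap=\cap$, $\sqcup=\cup$, $a\to b$ = the largest decreasing set contained in $(K_n\setminus a)\cup b$). By a theorem of Bellissima, the Heyting sub-algebra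 of $\widehat{\mathcal F_n}$ generated by $g_i=\{w\in K_n: P_i\in\mathrm{val}(w)\}$, $i=1,\dots,n$, is free on $g_1,\dots,g_n$; the free Heyting algebra $\mathcal F_n$ is identified with it. An element of a lattice is $\bigsqcup$-irreducible (completely join-irreducible) if it cannot be written as a (possibly infinite, possibly empty) join of other elements; it is completely meet-irreducible if it cannot be written as a (possibly infinite, possibly empty) meet of other elements. Joins and meets are taken in the lattice under consideration. -}

module Defs where

open import Level using (0ℓ; _⊔_; suc)
open import Data.Nat.Base as ℕ using (ℕ; _≤′_; ≤′-refl; ≤′-step)
import Data.Nat.Properties as ℕₚ
open import Data.Bool.Base using (Bool; T)
open import Data.Empty as Empty using ()
open import Data.Unit as Unit using ()
open import Data.Fin.Base using (Fin)
open import Data.Fin.Subset using (Subset; _∈_; _⊆_)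
import Data.Fin.Subset.Properties as Subsetₚ
open import Data.Product.Base using (Σ; ∃; ∃-syntax; _×_; _,_; proj₁; proj₂)
open import Data.Sum.Base using (_⊎_; inj₁; inj₂; [_,_])
open import Function.Base using (_∘_; id)
open import Function.Bundles using (_⇔_)
open import Relation.Nullary.Negation.Core using (¬_; contradiction)
import Relation.Unary as U
open import Relation.Unary using (Pred; _⊈_; _≐_; _∪_; _∩_; _⇒_; ∅)
open import Relation.Binary.Core using (Rel)
open import Relation.Binary.Bundles using (Poset)
open import Relation.Binary.Lattice.Bundles using (HeytingAlgebra)
open import Relation.Binary.PropositionalEquality
  using (_≡_; _≢_; _≗_; refl; sym; trans; cong; subst; subst₂)

-- A stage stands for one of the sets K^d with its order and valuation.
-- `Fresh Y` says that Y is not contained in the stage before.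
record Stage (n : ℕ) : Set₁ where
  field
    poset        : Poset 0ℓ 0ℓ 0ℓ
  open Poset poset public renaming (Carrier to Point; refl to ≤-refl; trans to ≤-trans)
  field
    val          : Point → Subset n
    val-antitone : ∀ {u v} → u ≤ v → val v ⊆ val u
    Fresh        : Pred (Point → Bool) 0ℓ

-- The new point w_{β,Y}.  Subsets of a stage are Bool-valued, so that all
-- stages live in Set; stages are finite up to _≈_, so classically this is no
-- restriction.
record New {n : ℕ} (S : Stage n) : Set where
  open Stage S
  field
    β             : Subset n
    Y             : Point → Bool
    decreasing    : ∀ {u v} → u ≤ v → T (Y v) → T (Y u)
    fresh         : Fresh Y
    β⊆val         : ∀ {u} → T (Y u) → β ⊆ val u
    notDuplicated : ∀ v → (∀ u → T (Y u) ⇔ u ≤ v) → β ≢ val v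

open New public using (β; Y)

-- One point for each pair (β , Y): new points are compared by their pairs,
-- ignoring the proofs and comparing Y extensionally.
_≈ⁿ_ : ∀ {n} {S : Stage n} → Rel (New S) 0ℓ
w ≈ⁿ w′ = β w ≡ β w′ × Y w ≗ Y w′

module Extension {n : ℕ} (S : Stage n) where
  open Stage S

  Point⁺ : Set
  Point⁺ = Point ⊎ New S

  infix 4 _≈⁺_ _≤⁺_

  _≈⁺_ : Rel Point⁺ 0ℓ
  inj₁ u ≈⁺ inj₁ v = u ≈ v
  inj₁ _ ≈⁺ inj₂ _ = Empty.⊥
  inj₂ _ ≈⁺ inj₁ _ = Empty.⊥
  inj₂ u ≈⁺ inj₂ v = u ≈ⁿ v

  _≤⁺_ : Rel Point⁺ 0ℓ
  inj₁ u ≤⁺ inj₁ v = u ≤ v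
  inj₁ u ≤⁺ inj₂ v = T (Y v u)
  inj₂ _ ≤⁺ inj₁ _ = Empty.⊥
  inj₂ u ≤⁺ inj₂ v = u ≈ⁿ v

  val⁺ : Point⁺ → Subset n
  val⁺ = [ val , β ]

  private
    ≈⁺-refl : ∀ {u} → u ≈⁺ u
    ≈⁺-refl {inj₁ u} = Eq.refl
    ≈⁺-refl {inj₂ u} = refl , λ _ → refl

    ≈⁺-sym : ∀ {u v} → u ≈⁺ v → v ≈⁺ u
    ≈⁺-sym {inj₁ u} {inj₁ v} p       = Eq.sym p
    ≈⁺-sym {inj₂ u} {inj₂ v} (p , q) = sym p , sym ∘ q

    ≈⁺-trans : ∀ {u v w} → u ≈⁺ v → v ≈⁺ w → u ≈⁺ w
    ≈⁺-trans {inj₁ u} {inj₁ v} {inj₁ w} p q = Eq.trans p q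
    ≈⁺-trans {inj₂ u} {inj₂ v} {inj₂ w} (p , p′) (q , q′) =
      trans p q , λ x → trans (p′ x) (q′ x)

    ≤⁺-reflexive : ∀ {u v} → u ≈⁺ v → u ≤⁺ v
    ≤⁺-reflexive {inj₁ u} {inj₁ v} p = reflexive p
    ≤⁺-reflexive {inj₂ u} {inj₂ v} p = p

    ≤⁺-trans : ∀ {u v w} → u ≤⁺ v → v ≤⁺ w → u ≤⁺ w
    ≤⁺-trans {inj₁ u} {inj₁ v} {inj₁ w} p q = ≤-trans p q
    ≤⁺-trans {inj₁ u} {inj₁ v} {inj₂ w} p q = New.decreasing w p q
    ≤⁺-trans {inj₁ u} {inj₂ v} {inj₂ w} p q = subst T (proj₂ q u) p
    ≤⁺-trans {inj₂ u} {inj₂ v} {inj₂ w} p q = ≈⁺-trans {inj₂ u} {inj₂ v} {inj₂ w} p q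

    ≤⁺-antisym : ∀ {u v} → u ≤⁺ v → v ≤⁺ u → u ≈⁺ v
    ≤⁺-antisym {inj₁ u} {inj₁ v} p q = antisym p q
    ≤⁺-antisym {inj₂ u} {inj₂ v} p q = p

    val⁺-antitone : ∀ {u v} → u ≤⁺ v → val⁺ v ⊆ val⁺ u
    val⁺-antitone {inj₁ u} {inj₁ v} p = val-antitone p
    val⁺-antitone {inj₁ u} {inj₂ v} p = New.β⊆val v p
    val⁺-antitone {inj₂ u} {inj₂ v} p = Subsetₚ.⊆-reflexive (sym (proj₁ p))

  extend : Stage n
  extend = record
    { poset = record
      { Carrier = Point⁺
      ; _≈_ = _≈⁺_
      ; _≤_ = _≤⁺_
      ; isPartialOrder = record
        { isPreorder = record
          { isEquivalence = record
            { refl  = λ {u} → ≈⁺-refl {u}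
            ; sym   = λ {u} {v} → ≈⁺-sym {u} {v}
            ; trans = λ {u} {v} {w} → ≈⁺-trans {u} {v} {w}
            }
          ; reflexive = λ {u} {v} → ≤⁺-reflexive {u} {v}
          ; trans     = λ {u} {v} {w} → ≤⁺-trans {u} {v} {w}
          }
        ; antisym = λ {u} {v} → ≤⁺-antisym {u} {v}
        }
      }
    ; val          = val⁺
    ; val-antitone = λ {u} {v} → val⁺-antitone {u} {v}
    ; Fresh        = λ Z → (T ∘ Z) ⊈ (λ u → ∃[ v ] u ≡ inj₁ v)
    }

open Extension public using (extend)

-- K^{-1}; there is no stage before it, so every subset counts as fresh.
emptyStage : (n : ℕ) → Stage n
emptyStage n = record
  { poset = record
    { Carrier = Empty.⊥
    ; _≈_ = λ _ _ → Empty.⊥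
    ; _≤_ = λ _ _ → Empty.⊥
    ; isPartialOrder = record
      { isPreorder = record
        { isEquivalence = record
          { refl = λ { {()} } ; sym = id ; trans = λ p _ → p }
        ; reflexive = id
        ; trans     = λ p _ → p
        }
      ; antisym = λ p _ → p
      }
    }
  ; val          = λ ()
  ; val-antitone = λ ()
  ; Fresh        = λ _ → Unit.⊤
  }

stage : (n d : ℕ) → Stage n
stage n ℕ.zero    = extend (emptyStage n)
stage n (ℕ.suc d) = extend (stage n d)

module _ (n : ℕ) where

  private
    module St (d : ℕ) = Stage (stage n d)
    open St using (Point)

  lift : ∀ {d e} → d ≤′ e → Point d → Point e
  lift ≤′-refl     u = u
  lift (≤′-step p) u = inj₁ (lift p u)

  -- The union of the stages: a point is a point of some stage, and points are
  -- compared in a stage containing both.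
  Pt : Set
  Pt = Σ ℕ Point

  InCommonStage : (∀ d → Rel (Point d) 0ℓ) → Rel Pt 0ℓ
  InCommonStage R (d , u) (e , v) =
    ∃[ m ] Σ (d ≤′ m) λ p → Σ (e ≤′ m) λ q → R m (lift p u) (lift q v)

  valK : Pt → Subset n
  valK (d , u) = St.val d u

  lift-irrelevant : ∀ {d e} (p q : d ≤′ e) (u : Point d) → lift p u ≡ lift q u
  lift-irrelevant ≤′-refl     ≤′-refl     u = refl
  lift-irrelevant ≤′-refl     (≤′-step q) u = contradiction (ℕₚ.≤′⇒≤ q) ℕₚ.1+n≰n
  lift-irrelevant (≤′-step p) ≤′-refl     u = contradiction (ℕₚ.≤′⇒≤ p) ℕₚ.1+n≰n
  lift-irrelevant (≤′-step p) (≤′-step q) u = cong inj₁ (lift-irrelevant p q u)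

  lift-trans : ∀ {d e m} (p : d ≤′ e) (q : e ≤′ m) (u : Point d) →
               lift q (lift p u) ≡ lift (ℕₚ.≤′-trans p q) u
  lift-trans p ≤′-refl     u = refl
  lift-trans p (≤′-step q) u = cong inj₁ (lift-trans p q u)

  val-lift : ∀ {d e} (p : d ≤′ e) (u : Point d) → St.val e (lift p u) ≡ St.val d u
  val-lift ≤′-refl     u = refl
  val-lift (≤′-step p) u = val-lift p u

  Stable : (∀ d → Rel (Point d) 0ℓ) → Set
  Stable R = ∀ d (u v : Point d) → R d u v → R (ℕ.suc d) (inj₁ u) (inj₁ v)

  lift-stable : ∀ R → Stable R → ∀ {d e} (p : d ≤′ e) (u v : Point d) →
                R d u v → R e (lift p u) (lift p v)
  lift-stable R st ≤′-refl     u v r = r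
  lift-stable R st (≤′-step p) u v r = st _ _ _ (lift-stable R st p u v r)

  -- A comparison made in stage m can be made in any later stage k, whichever
  -- proofs of inequality are used for the embeddings.
  relift : ∀ R → Stable R → ∀ {d e m k} (u : Point d) (v : Point e)
           (p : d ≤′ m) (q : e ≤′ m) → m ≤′ k → (p′ : d ≤′ k) (q′ : e ≤′ k) →
           R m (lift p u) (lift q v) → R k (lift p′ u) (lift q′ v)
  relift R st {k = k} u v p q a p′ q′ r =
    subst₂ (R k)
      (trans (lift-trans p a u) (lift-irrelevant (ℕₚ.≤′-trans p a) p′ u))
      (trans (lift-trans q a v) (lift-irrelevant (ℕₚ.≤′-trans q a) q′ v))
      (lift-stable R st a (lift p u) (lift q v) r)

  private
    -- Two comparisons sharing a point can be made in the same stage.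
    meetUp : ∀ R → Stable R → ∀ {x y z} →
             InCommonStage R x y → InCommonStage R y z →
             ∃[ m ] Σ (proj₁ x ≤′ m) λ p → Σ (proj₁ y ≤′ m) λ q → Σ (proj₁ z ≤′ m) λ r →
             R m (lift p (proj₂ x)) (lift q (proj₂ y)) ×
             R m (lift q (proj₂ y)) (lift r (proj₂ z))
    meetUp R st {_ , x} {_ , y} {_ , z} (m , p , q , r) (m′ , p′ , q′ , r′) =
      m ℕ.⊔ m′ , ℕₚ.≤′-trans p a , ℕₚ.≤′-trans q a , ℕₚ.≤′-trans q′ b ,
      relift R st x y p q a _ _ r , relift R st y z p′ q′ b _ _ r′
      where
      a : m ≤′ m ℕ.⊔ m′
      a = ℕₚ.≤⇒≤′ (ℕₚ.m≤m⊔n m m′)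
      b : m′ ≤′ m ℕ.⊔ m′
      b = ℕₚ.≤⇒≤′ (ℕₚ.m≤n⊔m m m′)

    ≈-st : Stable St._≈_
    ≈-st _ _ _ = id

    ≤-st : Stable St._≤_
    ≤-st _ _ _ = id

  K : Poset 0ℓ 0ℓ 0ℓ
  K = record
    { Carrier = Pt
    ; _≈_ = InCommonStage St._≈_
    ; _≤_ = InCommonStage St._≤_
    ; isPartialOrder = record
      { isPreorder = record
        { isEquivalence = record
          { refl  = λ { {d , u} → d , ≤′-refl , ≤′-refl , St.Eq.refl d {u} }
          ; sym   = λ { (m , p , q , r) → m , q , p , St.Eq.sym m r }
          ; trans = λ {x} {y} {z} r s →
              let (m , p , _ , q , r′ , s′) = meetUp St._≈_ ≈-st {x} {y} {z} r s
              in m , p , q , St.Eq.trans m r′ s′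
          }
        ; reflexive = λ { (m , p , q , r) → m , p , q , St.reflexive m r }
        ; trans     = λ {x} {y} {z} r s →
            let (m , p , _ , q , r′ , s′) = meetUp St._≤_ ≤-st {x} {y} {z} r s
            in m , p , q , St.≤-trans m r′ s′
        }
      ; antisym = λ {x} {y} r s →
          let (m , p , q , p′ , r′ , s′) = meetUp St._≤_ ≤-st {x} {y} {x} r s
          in m , p , q , St.antisym m r′
               (subst (St._≤_ m (lift q (proj₂ y))) (lift-irrelevant p′ p (proj₂ x)) s′)
      }
    }

  valK-antitone : ∀ {x y} → Poset._≤_ K x y → valK y ⊆ valK x
  valK-antitone {d , u} {e , v} (m , p , q , r) i∈ =
    subst (_ ∈_) (val-lift p u)
      (St.val-antitone m r (subst (_ ∈_) (sym (val-lift q v)) i∈))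

module _ (P : Poset 0ℓ 0ℓ 0ℓ) where
  open Poset P renaming (trans to ≤-trans; refl to ≤-refl)

  DownSet : Set₁
  DownSet = Σ (Pred Carrier 0ℓ) λ A → ∀ {u v} → u ≤ v → A v → A u

  -- The implication is the set of points all of whose lower bounds lie in
  -- A ⇒ B.  Classically A ⇒ B is (K ∖ A) ∪ B, so this is the largest decreasing
  -- set contained in (K ∖ A) ∪ B.
  𝒪↓ : HeytingAlgebra (suc 0ℓ) 0ℓ 0ℓ
  𝒪↓ = record
    { Carrier = DownSet
    ; _≈_ = λ (A , _) (B , _) → A ≐ B
    ; _≤_ = λ (A , _) (B , _) → A U.⊆ B
    ; _∨_ = λ (A , a↓) (B , b↓) →
        A ∪ B , λ u≤v → [ inj₁ ∘ a↓ u≤v , inj₂ ∘ b↓ u≤v ]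
    ; _∧_ = λ (A , a↓) (B , b↓) →
        A ∩ B , λ u≤v (a , b) → a↓ u≤v a , b↓ u≤v b
    ; _⇨_ = λ (A , _) (B , _) →
        (λ w → ∀ v → v ≤ w → (A ⇒ B) v) ,
        λ u≤v f w w≤u → f w (≤-trans w≤u u≤v)
    ; ⊤ = U.U , _
    ; ⊥ = ∅ , λ _ ()
    ; isHeytingAlgebra = record
      { isBoundedLattice = record
        { isLattice = record
          { isPartialOrder = record
            { isPreorder = record
              { isEquivalence = record
                { refl  = id , id
                ; sym   = λ (p , q) → q , p
                ; trans = λ (p , q) (p′ , q′) → p′ ∘ p , q ∘ q′
                }
              ; reflexive = proj₁
              ; trans     = λ p q → q ∘ p
              }
            ; antisym = _,_
            }
          ; supremum = λ _ _ → inj₁ , inj₂ , λ _ p q → [ p , q ]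
          ; infimum  = λ _ _ → proj₁ , proj₂ , λ _ p q c → p c , q c
          }
        ; maximum = λ _ _ → _
        ; minimum = λ _ ()
        }
      ; exponential = λ (_ , w↓) _ _ →
          (λ f c v v≤u a → f (w↓ v≤u c , a)) ,
          (λ f (c , a) → f c _ ≤-refl a)
      }
    }

module _ {c ℓ₁ ℓ₂ i} (H : HeytingAlgebra c ℓ₁ ℓ₂) {I : Set i}
         (g : I → HeytingAlgebra.Carrier H) where
  open HeytingAlgebra H

  data Generated : Pred Carrier (c ⊔ ℓ₁ ⊔ i) where
    gen  : ∀ j → Generated (g j)
    top  : Generated ⊤
    bot  : Generated ⊥
    join : ∀ {a b} → Generated a → Generated b → Generated (a ∨ b)
    meet : ∀ {a b} → Generated a → Generated b → Generated (a ∧ b)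
    impl : ∀ {a b} → Generated a → Generated b → Generated (a ⇨ b)
    resp : ∀ {a b} → a ≈ b → Generated a → Generated b

  generatedSubalgebra : HeytingAlgebra (c ⊔ ℓ₁ ⊔ i) ℓ₁ ℓ₂
  generatedSubalgebra = record
    { Carrier = ∃ Generated
    ; _≈_ = λ (a , _) (b , _) → a ≈ b
    ; _≤_ = λ (a , _) (b , _) → a ≤ b
    ; _∨_ = λ (a , p) (b , q) → a ∨ b , join p q
    ; _∧_ = λ (a , p) (b , q) → a ∧ b , meet p q
    ; _⇨_ = λ (a , p) (b , q) → a ⇨ b , impl p q
    ; ⊤ = ⊤ , top
    ; ⊥ = ⊥ , bot
    ; isHeytingAlgebra = record
      { isBoundedLattice = record
        { isLattice = record
          { isPartialOrder = record
            { isPreorder = record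
              { isEquivalence = record
                { refl = Eq.refl ; sym = Eq.sym ; trans = Eq.trans }
              ; reflexive = reflexive
              ; trans     = HeytingAlgebra.trans H
              }
            ; antisym = antisym
            }
          ; supremum = λ (a , _) (b , _) → let (p , q , r) = supremum a b in
              p , q , λ (c , _) → r c
          ; infimum  = λ (a , _) (b , _) → let (p , q , r) = infimum a b in
              p , q , λ (c , _) → r c
          }
        ; maximum = λ (a , _) → maximum a
        ; minimum = λ (a , _) → minimum a
        }
      ; exponential = λ (a , _) (b , _) (c , _) → exponential a b c
      }
    }

module _ {c ℓ₁ ℓ₂} (H : HeytingAlgebra c ℓ₁ ℓ₂) where
  open HeytingAlgebra H

  IsJoin : ∀ {i} {I : Set i} → (I → Carrier) → Carrier → Set _
  IsJoin f x = (∀ i → f i ≤ x) × (∀ y → (∀ i → f i ≤ y) → x ≤ y)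

  IsMeet : ∀ {i} {I : Set i} → (I → Carrier) → Carrier → Set _
  IsMeet f x = (∀ i → x ≤ f i) × (∀ y → (∀ i → y ≤ f i) → y ≤ x)

  -- Families are indexed by sets in the universe of the carrier, which covers
  -- every subset of the carrier.
  CompletelyJoinIrreducible : Pred Carrier _
  CompletelyJoinIrreducible x =
    ¬ (Σ (Set c) λ I → Σ (I → Carrier) λ f → (∀ i → ¬ (f i ≈ x)) × IsJoin f x)

  CompletelyMeetIrreducible : Pred Carrier _
  CompletelyMeetIrreducible x =
    ¬ (Σ (Set c) λ I → Σ (I → Carrier) λ f → (∀ i → ¬ (f i ≈ x)) × IsMeet f x)

F̂ : ℕ → HeytingAlgebra (suc 0ℓ) 0ℓ 0ℓ
F̂ n = 𝒪↓ (K n)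

g : (n : ℕ) → Fin n → HeytingAlgebra.Carrier (F̂ n)
g n i = (λ w → i ∈ valK n w) , λ {u} {v} u≤v → valK-antitone n {u} {v} u≤v

F : ℕ → HeytingAlgebra (suc 0ℓ) 0ℓ 0ℓ
F n = generatedSubalgebra (F̂ n) (g n)

{-# OPTIONS --safe #-}
module Submission where

-- In any lattice of decreasing subsets of K that contains every ↓ w and every
-- K ∖ ↑ w, these are exactly the completely join- and meet-irreducible elements:
-- a decreasing set a is the union of the ↓ w with w ∈ a and the intersection of
-- the K ∖ ↑ w with w ∉ a, while (↓ w , K ∖ ↑ w) splits the lattice into the elements
-- containing w and the elements contained in K ∖ ↑ w.  So it suffices that both sets
-- lie in the free algebra.  This is de Jongh's argument, by induction on w: writing
-- β for val w and Y for the set of points strictly below w, a finite set,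
--   ↓ w     = ⋀_{i ∈ β} g i ∧ ((⋁_{i ∉ β} g i ∨ ⋁_{y ∈ Y} (K ∖ ↑ y)) → ⋁_{y ∈ Y} ↓ y)
--   K ∖ ↑ w = ↓ w → ⋁_{y ∈ Y} ↓ y.
-- A point v ∉ Y of the right-hand side of the first equation has valuation β and lies
-- above all of Y.  A minimal such v has Y as its strict down-set, so it is w; and a
-- v properly above w, minimal with that property, would be a duplicate of w, which
-- condition (iii) forbids.

open import Defs
open import Level using (0ℓ; suc; Lift; lower)
open import Axiom.ExcludedMiddle using (ExcludedMiddle)
open import Axiom.DoubleNegationElimination using (em⇒dne)
open import Data.Bool.Base using (Bool; true; false; T)
open import Data.Empty using (⊥-elim)
open import Data.Fin.Base using (Fin)
open import Data.Fin.Subset using (Subset; _⊆_) renaming (_∈_ to _∈ˢ_)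
open import Data.Fin.Subset.Properties using (_∈?_; ⊆-antisym)
open import Data.List.Base using (List; []; _∷_; filter; allFin; map; _++_; cartesianProductWith)
open import Data.List.Membership.Propositional using (_∈_; find; lose)
open import Data.List.Membership.Propositional.Properties
  using (∈-filter⁺; ∈-filter⁻; ∈-allFin; ∈-cartesianProductWith⁺)
open import Data.List.Relation.Unary.All as All using (All; []; _∷_)
open import Data.List.Relation.Unary.Any as Any using (Any; here; there)
import Data.List.Relation.Unary.Any.Properties as Anyₚ
open import Data.Nat.Base as ℕ using (ℕ; _≤_; _≤′_; ≤′-refl; ≤′-step)
open import Data.Nat.Properties using (m≤m⊔n; m≤n⊔m; ≤⇒≤′)
open import Data.Product.Base using (Σ; ∃; ∃-syntax; _×_; _,_; proj₁; proj₂)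
open import Data.Sum.Base using (_⊎_; inj₁; inj₂; [_,_]; map₁; fromInj₁)
open import Data.Vec.Base as Vec using (Vec; []; _∷_)
open import Data.Vec.Properties using (++-injective; ∷-injective)
open import Function.Base using (_∘_; id)
open import Function.Bundles using (_⇔_; mk⇔; Equivalence)
open import Induction.WellFounded using (WellFounded; Acc; acc; Acc-resp-≈)
open import Relation.Binary.Bundles using (Poset)
open import Relation.Binary.Core using (Rel)
import Relation.Binary.Properties.Poset as PosetProperties
open import Relation.Binary.Lattice.Bundles using (HeytingAlgebra)
open import Relation.Binary.PropositionalEquality
  using (_≡_; _≢_; refl; sym; trans; cong; subst)
open import Relation.Nullary using (¬_; yes; no; contradiction)
open import Relation.Nullary.Decidable using (¬?; map′)
open import Relation.Unary using (Pred; _≐_; ⋃; ⋂)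
open import Relation.Unary.Properties using (≐-refl; ≐-sym; ≐-trans)
open HeytingAlgebra using (Carrier)

-- Principal decreasing sets, their duals, finite unions and intersections.

module _ (P : Poset 0ℓ 0ℓ 0ℓ) where
  open Poset P using () renaming (Carrier to A; _≤_ to _⊑_; trans to ≤-trans)

  principal : A → DownSet P
  principal w = (_⊑ w) , ≤-trans

  coprincipal : A → DownSet P
  coprincipal w = (λ u → ¬ w ⊑ u) , λ u≤v w≰v w≤u → w≰v (≤-trans w≤u u≤v)

  ⋃ᴸ ⋂ᴸ : ∀ {I : Set} → (I → DownSet P) → List I → DownSet P
  ⋃ᴸ A is = (λ u → Any (λ i → proj₁ (A i) u) is) , λ u≤v → Any.map (λ {i} → proj₂ (A i) u≤v)
  ⋂ᴸ A is = (λ u → All (λ i → proj₁ (A i) u) is) , λ u≤v → All.map (λ {i} → proj₂ (A i) u≤v)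

  module _ {J : Set} {g : J → DownSet P} {I : Set} (A : I → DownSet P) where

    ⋃ᴸ-generated : ∀ {is} → All (Generated (𝒪↓ P) g ∘ A) is → Generated (𝒪↓ P) g (⋃ᴸ A is)
    ⋃ᴸ-generated []       = resp ((λ ()) , λ ()) bot
    ⋃ᴸ-generated (p ∷ ps) = resp (Any.fromSum , Any.toSum) (join p (⋃ᴸ-generated ps))

    ⋂ᴸ-generated : ∀ {is} → All (Generated (𝒪↓ P) g ∘ A) is → Generated (𝒪↓ P) g (⋂ᴸ A is)
    ⋂ᴸ-generated []       = resp ((λ _ → []) , _) top
    ⋂ᴸ-generated (p ∷ ps) = resp ((λ (a , as) → a ∷ as) , All.uncons) (meet p (⋂ᴸ-generated ps))

-- Order-theoretic properties of `K` on which de Jongh's argument rests.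

module _ {n : ℕ} (P : Poset 0ℓ 0ℓ 0ℓ) (val : Poset.Carrier P → Subset n) where
  open Poset P using (_≈_) renaming (_≤_ to _⊑_)
  open PosetProperties P using (_<_)

  -- At most one point for each pair (β, Y), where Y is read as the strict down-set.
  Separated : Set
  Separated = ∀ u v → val u ≡ val v → (_< u) ≐ (_< v) → u ≈ v

  -- Condition (iii), with the generated set Y read as the strict down-set of `u`.
  Unduplicated : Set
  Unduplicated = ∀ u v → (_< u) ≐ (_⊑ v) → val u ≢ val v

module _ (P : Poset 0ℓ 0ℓ 0ℓ) where
  open Poset P using (_≈_) renaming (_≤_ to _⊑_)

  -- The list covers the down-set up to `_≈_` and may contain points outside it.
  FiniteDownSets : Set
  FiniteDownSets = ∀ w → ∃[ us ] ∀ u → u ⊑ w → Any (u ≈_) us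

-- De Jongh's formulas.

module DeJongh
  (em : ExcludedMiddle 0ℓ) {n : ℕ} (P : Poset 0ℓ 0ℓ 0ℓ)
  (val : Poset.Carrier P → Subset n)
  (val-antitone : ∀ {u v} → Poset._≤_ P u v → val v ⊆ val u)
  (wellFounded : WellFounded (PosetProperties._<_ P))
  (separated : Separated P val) (unduplicated : Unduplicated P val)
  (finiteDownSets : FiniteDownSets P)
  where

  open Poset P using (_≈_; module Eq; reflexive; antisym; ≤-respˡ-≈; ≤-respʳ-≈)
    renaming (_≤_ to _⊑_; Carrier to A; refl to ≤-refl; trans to ≤-trans)
  open PosetProperties P using (_<_; <-respˡ-≈)

  atom : Fin n → DownSet P
  atom i = (λ w → i ∈ˢ val w) , λ u≤v → val-antitone u≤v

  ≤-<-trans : ∀ {u v w} → u ⊑ v → v < w → u < w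
  ≤-<-trans u≤v (v≤w , v≉w) =
    ≤-trans u≤v v≤w , λ u≈w → v≉w (antisym v≤w (≤-respˡ-≈ u≈w u≤v))

  ≤⇒<⊎≈ : ∀ {u v} → u ⊑ v → u < v ⊎ u ≈ v
  ≤⇒<⊎≈ {u} {v} u≤v with em {u ≈ v}
  ... | yes u≈v = inj₂ u≈v
  ... | no  u≉v = inj₁ (u≤v , u≉v)

  module _ (w : A) where

    below : List A
    below = filter (λ y → em {y < w}) (proj₁ (finiteDownSets w))

    below-< : ∀ {y} → y ∈ below → y < w
    below-< = proj₂ ∘ ∈-filter⁻ _ {xs = proj₁ (finiteDownSets w)}

    below-complete : ∀ {y} → y < w → Any (y ≈_) below
    below-complete {y} y<w =
      -- Filtering keeps the entry found or shows that it is not strictly below `w`; the latter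
      -- fails because the entry is equivalent to `y`.
      fromInj₁ (contradiction (<-respˡ-≈ (Anyₚ.lookup-result ys) y<w))
        (Anyₚ.filter⁺ (λ y → em {y < w}) ys)
      where
      ys : Any (y ≈_) (proj₁ (finiteDownSets w))
      ys = proj₂ (finiteDownSets w) y (proj₁ y<w)

    positive negative : List (Fin n)
    positive = filter (_∈? val w) (allFin n)
    negative = filter (λ i → ¬? (i ∈? val w)) (allFin n)

    strictlyBelow : DownSet P
    strictlyBelow = ⋃ᴸ P (principal P) below

    strictlyBelow-< : ∀ {u} → proj₁ strictlyBelow u → u < w
    strictlyBelow-< u∈ = let (y , y∈ , u≤y) = find u∈ in ≤-<-trans u≤y (below-< y∈)

    <-strictlyBelow : ∀ {u} → u < w → proj₁ strictlyBelow u
    <-strictlyBelow = Any.map reflexive ∘ below-complete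

    open HeytingAlgebra (𝒪↓ P) using (_∧_; _∨_; _⇨_)

    formula : DownSet P
    formula = ⋂ᴸ P atom positive ∧
      ((⋃ᴸ P atom negative ∨ ⋃ᴸ P (coprincipal P) below) ⇨ strictlyBelow)

    -- A decreasing set contains `↓ w` once it contains `w`. For the implication, points strictly
    -- below `w` satisfy the conclusion and points equivalent to `w` fail the premise (`atTop`).
    ≤⇒formula : ∀ {u} → u ⊑ w → proj₁ formula u
    ≤⇒formula {u} u≤w = proj₂ formula u≤w
      ( All.tabulate (proj₂ ∘ ∈-filter⁻ (_∈? val w) {xs = allFin n})
      , λ v v≤w a → fromInj₁ (λ v≈w → ⊥-elim (atTop v≈w a)) (map₁ <-strictlyBelow (≤⇒<⊎≈ v≤w)))
      where
      atTop : ∀ {v} → v ≈ w → ¬ proj₁ (⋃ᴸ P atom negative ∨ ⋃ᴸ P (coprincipal P) below) v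
      atTop v≈w (inj₁ a) =
        let (i , i∈ , i∈v) = find a
        in proj₂ (∈-filter⁻ (λ i → ¬? (i ∈? val w)) {xs = allFin n} i∈)
             (val-antitone (reflexive (Eq.sym v≈w)) i∈v)
      atTop v≈w (inj₂ a) =
        let (y , y∈ , y≰v) = find a
        in y≰v (≤-respʳ-≈ (Eq.sym v≈w) (proj₁ (below-< y∈)))

    -- The positive atoms give one inclusion. An atom of `v` outside `val w` would make the premise
    -- true at `v` and force `v < w`.
    formula-val : ∀ {v} → proj₁ formula v → ¬ v < w → val v ≡ val w
    formula-val {v} (pos , imp) v≮w = ⊆-antisym val⊆ ⊆val
      where
      ⊆val : val w ⊆ val v
      ⊆val i∈w = All.lookup pos (∈-filter⁺ _ (∈-allFin _) i∈w)
      val⊆ : val v ⊆ val w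
      val⊆ {i} i∈v with i ∈? val w
      ... | yes i∈w = i∈w
      ... | no  i∉w =
        let i∈negative = ∈-filter⁺ (λ i → ¬? (i ∈? val w)) (∈-allFin i) i∉w
        in contradiction (strictlyBelow-< (imp v ≤-refl (inj₁ (lose i∈negative i∈v)))) v≮w

    -- If `y` were not below `v`, then `v` would lie in the member `K ∖ ↑ y` of the premise, which
    -- again forces `v < w`.
    formula-above : ∀ {v} → proj₁ formula v → ¬ v < w → ∀ {y} → y < w → y < v
    formula-above {v} (_ , imp) v≮w {y} y<w with em {y ⊑ v}
    ... | yes y≤v = y≤v , λ y≈v → v≮w (<-respˡ-≈ y≈v y<w)
    ... | no  y≰v = contradiction
      (strictlyBelow-< (imp v ≤-refl (inj₂
        (Any.map (λ y≈z z≤v → y≰v (≤-trans (reflexive y≈z) z≤v)) (below-complete y<w)))))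
      v≮w

    -- Well-founded induction on `v` stands in for the choice of a minimal point: every `u < v`
    -- satisfies `formula` too, hence is below `w`.
    formula⇒<⊎≈ : ∀ {v} → Acc _<_ v → proj₁ formula v → v < w ⊎ v ≈ w
    formula⇒<⊎≈ {v} (acc rec) φ with em {v < w} | em {w < v}
    ... | yes v<w | _       = inj₁ v<w
    -- Here the strict down-set of `v` is exactly `↓ w`, so `v` would duplicate `w`.
    ... | no  v≮w | yes w<v = contradiction (formula-val φ v≮w)
      (unduplicated v w
        ( (λ u<v → [ proj₁ , reflexive ] (formula⇒<⊎≈ (rec u<v) (proj₂ formula (proj₁ u<v) φ)))
        , λ u≤w → [ formula-above φ v≮w , (λ u≈w → <-respˡ-≈ (Eq.sym u≈w) w<v) ] (≤⇒<⊎≈ u≤w)))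
    -- Now no `u < v` is equivalent to `w`, so `v` and `w` have the same strict down-set.
    ... | no  v≮w | no  w≮v = inj₂ (separated v w (formula-val φ v≮w)
      ( (λ u<v → fromInj₁ (λ u≈w → contradiction (<-respˡ-≈ u≈w u<v) w≮v)
                   (formula⇒<⊎≈ (rec u<v) (proj₂ formula (proj₁ u<v) φ)))
      , formula-above φ v≮w))

    formula≐principal : proj₁ formula ≐ (_⊑ w)
    formula≐principal =
      (λ {v} → [ proj₁ , reflexive ] ∘ formula⇒<⊎≈ (wellFounded v)) , ≤⇒formula

    -- If `w ⊑ u`, testing the implication at `w` gives `w < w`. Otherwise no point below both `u`
    -- and `w` is equivalent to `w`.
    ⇨≐coprincipal : proj₁ (principal P w ⇨ strictlyBelow) ≐ (λ u → ¬ w ⊑ u)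
    ⇨≐coprincipal =
      (λ f w≤u → proj₂ (strictlyBelow-< (f w w≤u ≤-refl)) Eq.refl) ,
      (λ w≰u v v≤u v≤w →
        [ <-strictlyBelow
        , (λ v≈w → contradiction (≤-trans (reflexive (Eq.sym v≈w)) v≤u) w≰u)
        ] (≤⇒<⊎≈ v≤w))

  Gen : Pred (DownSet P) (suc 0ℓ)
  Gen = Generated (𝒪↓ P) atom

  -- Both sets are treated in one induction: the formula for `↓ w` mentions `↓ y` and `K ∖ ↑ y` for
  -- every `y < w`.
  generated : ∀ {w} → Acc _<_ w → Gen (principal P w) × Gen (coprincipal P w)
  generated {w} (acc rec) =
    principal-generated , resp (⇨≐coprincipal w) (impl principal-generated strictlyBelow-generated)
    where
    ih : All (λ y → Gen (principal P y) × Gen (coprincipal P y)) (below w)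
    ih = All.tabulate (generated ∘ rec ∘ below-< w)
    strictlyBelow-generated : Gen (strictlyBelow w)
    strictlyBelow-generated = ⋃ᴸ-generated P _ (All.map proj₁ ih)
    principal-generated : Gen (principal P w)
    principal-generated = resp (formula≐principal w)
      (meet (⋂ᴸ-generated P _ (All.universal gen _))
        (impl (join (⋃ᴸ-generated P _ (All.universal gen _))
                    (⋃ᴸ-generated P _ (All.map proj₂ ih)))
              strictlyBelow-generated))

-- Invariants of the stages.

module _ {n : ℕ} where

  -- What is carried from stage to stage so that the hypotheses of `DeJongh` hold in the union.
  record Regular (S : Stage n) : Set where
    open Stage S using (poset; val; Point; Fresh; _≈_)
    open PosetProperties poset using (_<_)
    field
      wellFounded  : WellFounded _<_
      separated    : Separated poset val
      unduplicated : Unduplicated poset val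
      finite       : ∃[ us ] ∀ (u : Point) → Any (u ≈_) us
      -- Keeps a new point from sharing its strict down-set with an older one.
      fresh        : ∀ Z → Fresh Z → ∀ v → ¬ (T ∘ Z) ≐ (_< v)

  emptyStage-regular : Regular (emptyStage n)
  emptyStage-regular = record
    { wellFounded  = λ ()
    ; separated    = λ ()
    ; unduplicated = λ ()
    ; finite       = [] , λ ()
    ; fresh        = λ _ _ ()
    }

-- Finitely many new points over a finite stage.

T-injective : ∀ {a b} → (T a → T b) → (T b → T a) → a ≡ b
T-injective {false} {false} _ _ = refl
T-injective {false} {true}  _ g = ⊥-elim (g _)
T-injective {true}  {false} f _ = ⊥-elim (f _)
T-injective {true}  {true}  _ _ = refl

bools : List Bool
bools = false ∷ true ∷ []

allVec : ∀ k → List (Vec Bool k)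
allVec ℕ.zero    = [] ∷ []
allVec (ℕ.suc k) = cartesianProductWith _∷_ bools (allVec k)

∈-allVec : ∀ {k} (v : Vec Bool k) → v ∈ allVec k
∈-allVec []          = here refl
∈-allVec (false ∷ v) = ∈-cartesianProductWith⁺ _∷_ {xs = bools} (here refl) (∈-allVec v)
∈-allVec (true ∷ v)  = ∈-cartesianProductWith⁺ _∷_ {xs = bools} (there (here refl)) (∈-allVec v)

map-≡⇒All : ∀ {A B : Set} {f g : A → B} (xs : List A) →
  Vec.map f (Vec.fromList xs) ≡ Vec.map g (Vec.fromList xs) → All (λ x → f x ≡ g x) xs
map-≡⇒All []       _ = []
map-≡⇒All (x ∷ xs) e = let (p , q) = ∷-injective e in p ∷ map-≡⇒All xs q

module _ (em : ExcludedMiddle 0ℓ) where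

  -- Not every code need be attained, so excluded middle selects a preimage of each listed code that
  -- has one and drops the others.
  kernel-representatives : ∀ {A C : Set} (c : A → C) (cs : List C) →
    ∃[ as ] ∀ a → c a ∈ cs → Any (λ b → c a ≡ c b) as
  kernel-representatives c []       = [] , λ _ ()
  kernel-representatives c (x ∷ cs) with kernel-representatives c cs | em {∃[ a ] c a ≡ x}
  ... | as , rep | yes (a , eq) = a ∷ as ,
    λ { _ (here p) → here (trans p (sym eq)) ; b (there p) → there (rep b p) }
  ... | as , rep | no ∄ = as ,
    λ { b (here p) → contradiction (b , p) ∄ ; b (there p) → rep b p }

  module _ {n : ℕ} (S : Stage n) where
    open Stage S using (Point; reflexive; module Eq)
      renaming (_≈_ to _≈ˢ_)

    -- `Y w` respects equivalence of points, so its values on the finite list `us` determine it.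
    -- Together with `β w` they form a bit vector of fixed length.
    new-finite : (∃[ us ] ∀ (u : Point) → Any (u ≈ˢ_) us) →
                 ∃[ ws ] ∀ w → Any (_≈ⁿ_ {S = S} w) ws
    new-finite (us , complete) =
      let (ws , rep) = kernel-representatives code (allVec _)
      in ws , λ w → Any.map (λ {w′} → code-injective w w′) (rep w (∈-allVec (code w)))
      where
      code : New S → Vec Bool _
      code w = β w Vec.++ Vec.map (Y w) (Vec.fromList us)

      Y-cong : ∀ (w : New S) {u v} → u ≈ˢ v → Y w u ≡ Y w v
      Y-cong w u≈v = T-injective (New.decreasing w (reflexive (Eq.sym u≈v)))
                                 (New.decreasing w (reflexive u≈v))

      code-injective : ∀ (w w′ : New S) → code w ≡ code w′ → w ≈ⁿ w′
      code-injective w w′ eq =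
        let (β≡ , Y≡) = ++-injective (β w) (β w′) eq
        in β≡ , λ u → All.lookupWith
             (λ e u≈v → trans (Y-cong w u≈v) (trans e (sym (Y-cong w′ u≈v))))
             (map-≡⇒All us Y≡) (complete u)

  -- Regularity passes to the next stage.

  module _ {n : ℕ} (S : Stage n) (regular : Regular S) where
    private
      module S = Stage S
      module R = Regular regular
      module S⁺ = Stage (extend S)
    open PosetProperties S.poset using (_<_)
    open PosetProperties S⁺.poset using () renaming (_<_ to _<⁺_)

    -- No new point lies below an old one, so descending from an old point stays in `S`.
    acc-old : ∀ {u} → Acc _<_ u → Acc _<⁺_ (inj₁ u)
    acc-old (acc rec) = acc λ { {inj₁ v} v<u → acc-old (rec v<u) ; {inj₂ _} (() , _) }

    acc-new : ∀ w → Acc _<⁺_ (inj₂ w)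
    acc-new w = acc λ { {inj₁ u} _ → acc-old (R.wellFounded u)
                      ; {inj₂ _} (v≈w , v≉w) → contradiction v≈w v≉w }

    below-isOld : ∀ u v → u <⁺ v → ∃[ u′ ] u ≡ inj₁ u′
    below-isOld (inj₁ u) _        _           = u , refl
    below-isOld (inj₂ _) (inj₂ _) (u≈v , u≉v) = contradiction u≈v u≉v

    -- `fresh` rules out the mixed cases, where the set `Y w` would be the strict down-set of an old
    -- point. The proofs `id` use that `inj₁ _ ≈⁺ inj₂ _` is empty by definition.
    separated⁺ : Separated S⁺.poset S⁺.val
    separated⁺ (inj₁ u) (inj₁ v) e (p , q) =
      R.separated u v e ((λ {x} → p {inj₁ x}) , (λ {x} → q {inj₁ x}))
    separated⁺ (inj₁ u) (inj₂ w) e (p , q) =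
      R.fresh (Y w) (New.fresh w) u
        ((λ {x} x∈Y → q {inj₁ x} (x∈Y , id)) , (λ {x} x<u → proj₁ (p {inj₁ x} x<u)))
    separated⁺ (inj₂ w) (inj₁ u) e (p , q) =
      R.fresh (Y w) (New.fresh w) u
        ((λ {x} x∈Y → p {inj₁ x} (x∈Y , id)) , (λ {x} x<u → proj₁ (q {inj₁ x} x<u)))
    separated⁺ (inj₂ w) (inj₂ w′) e (p , q) =
      e , λ x → T-injective (λ t → proj₁ (p {inj₁ x} (t , id))) (λ t → proj₁ (q {inj₁ x} (t , id)))

    unduplicated⁺ : Unduplicated S⁺.poset S⁺.val
    unduplicated⁺ (inj₁ u) (inj₁ v) (p , q) =
      R.unduplicated u v ((λ {x} → p {inj₁ x}) , (λ {x} → q {inj₁ x}))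
    unduplicated⁺ (inj₂ w) (inj₁ v) (p , q) =
      New.notDuplicated w v λ u →
        mk⇔ (λ u∈Y → p {inj₁ u} (u∈Y , id)) (λ u≤v → proj₁ (q {inj₁ u} u≤v))
    -- The new point would lie in its own down-set, hence strictly below `u`, where only old points
    -- occur.
    unduplicated⁺ u (inj₂ w) (_ , q) _
      with below-isOld (inj₂ w) u (q {inj₂ w} (refl , λ _ → refl))
    ... | _ , ()

    extend-regular : Regular (extend S)
    extend-regular = record
      { wellFounded  = [ acc-old ∘ R.wellFounded , acc-new ]
      ; separated    = separated⁺
      ; unduplicated = unduplicated⁺
      ; finite       =
          let (us , us-complete) = R.finite
              (ws , ws-complete) = new-finite S R.finite
          in map inj₁ us ++ map inj₂ ws ,
             [ (λ u → Anyₚ.++⁺ˡ (Anyₚ.map⁺ (us-complete u)))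
             , (λ w → Anyₚ.++⁺ʳ (map inj₁ us) (Anyₚ.map⁺ (ws-complete w))) ]
      -- A strict down-set of the extension has only old points, whereas a fresh set is not
      -- contained in the old points.
      ; fresh        = λ Z Z-fresh v (p , _) → Z-fresh λ {u} u∈Z → below-isOld u v (p u∈Z)
      }

  stage-regular : ∀ n d → Regular (stage n d)
  stage-regular n ℕ.zero    = extend-regular _ emptyStage-regular
  stage-regular n (ℕ.suc d) = extend-regular _ (stage-regular n d)

-- From the stages to their union.

module _ (n : ℕ) where
  private
    module St (d : ℕ) = Stage (stage n d)
    module K = Poset (K n)
  open PosetProperties (K n) using ()
    renaming (_<_ to _<ᴷ_; <-respˡ-≈ to <ᴷ-respˡ-≈; <-respʳ-≈ to <ᴷ-respʳ-≈)

  Reflected : (∀ d → Rel (St.Point d) 0ℓ) → Set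
  Reflected R = ∀ d (u v : St.Point d) → R (ℕ.suc d) (inj₁ u) (inj₁ v) → R d u v

  -- Counterpart of `lift-stable`: two points of one stage are related in `K` only if they already
  -- are in that stage.
  lift-reflect : ∀ R → Reflected R → ∀ {d e} (p q : d ≤′ e) (u v : St.Point d) →
                 R e (lift n p u) (lift n q v) → R d u v
  lift-reflect R re {e = e} p q u v r =
    go p (subst (λ x → R e (lift n p u) x) (lift-irrelevant n q p v) r)
    where
    go : ∀ {e} (p : _ ≤′ e) → R e (lift n p u) (lift n p v) → R _ u v
    go ≤′-refl     r = r
    go (≤′-step p) r = go p (re _ _ _ r)

  module _ (d : ℕ) where

    stage-≈⇒ : ∀ {u v} → St._≈_ d u v → (d , u) K.≈ (d , v)
    stage-≈⇒ r = d , ≤′-refl , ≤′-refl , r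

    stage-≈⇐ : ∀ {u v} → (d , u) K.≈ (d , v) → St._≈_ d u v
    stage-≈⇐ {u} {v} (_ , p , q , r) = lift-reflect St._≈_ (λ _ _ _ → id) p q u v r

    stage-≤⇒ : ∀ {u v} → St._≤_ d u v → (d , u) K.≤ (d , v)
    stage-≤⇒ r = d , ≤′-refl , ≤′-refl , r

    stage-≤⇐ : ∀ {u v} → (d , u) K.≤ (d , v) → St._≤_ d u v
    stage-≤⇐ {u} {v} (_ , p , q , r) = lift-reflect St._≤_ (λ _ _ _ → id) p q u v r

  lift-≈ : ∀ {d e} (p : d ≤′ e) u → (d , u) K.≈ (e , lift n p u)
  lift-≈ {e = e} p u = e , p , ≤′-refl , St.Eq.refl e

  -- Each stage is a decreasing subset of every later one: in the successor step a new point below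
  -- an old one is impossible, hence no clause for `inj₂`.
  ≤-lift⇒lifted : ∀ {d e} (p : d ≤′ e) u v → St._≤_ e u (lift n p v) → ∃[ u′ ] u ≡ lift n p u′
  ≤-lift⇒lifted ≤′-refl     u        v _ = u , refl
  ≤-lift⇒lifted (≤′-step p) (inj₁ u) v r =
    let (u′ , e) = ≤-lift⇒lifted p u v r in u′ , cong inj₁ e

  ≤-stage : ∀ {d} u v → u K.≤ (d , v) → ∃[ u′ ] u K.≈ (d , u′)
  ≤-stage {d} (e , u) v (m , p , q , r) =
    let (u′ , eq) = ≤-lift⇒lifted q (lift n p u) v r
    in u′ , m , p , q , St.Eq.reflexive m eq

  private
    module St< (d : ℕ) = PosetProperties (St.poset d)

  module _ {d e : ℕ} (p : d ≤′ e) (u : St.Point d) (x : St.Point e) where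

    ≤-lift⇒ : St._≤_ e x (lift n p u) → (e , x) K.≤ (d , u)
    ≤-lift⇒ r = K.≤-respʳ-≈ {e , x} {e , lift n p u} {d , u}
      (K.Eq.sym {d , u} {e , lift n p u} (lift-≈ p u)) (stage-≤⇒ e r)

    ≤-lift⇐ : (e , x) K.≤ (d , u) → St._≤_ e x (lift n p u)
    ≤-lift⇐ r = stage-≤⇐ e (K.≤-respʳ-≈ {e , x} {d , u} {e , lift n p u} (lift-≈ p u) r)

    <-lift⇒ : St<._<_ e x (lift n p u) → (e , x) <ᴷ (d , u)
    <-lift⇒ (x≤u , x≉u) = ≤-lift⇒ x≤u , λ x≈u →
      x≉u (stage-≈⇐ e (K.Eq.trans {e , x} {d , u} {e , lift n p u} x≈u (lift-≈ p u)))

    <-lift⇐ : (e , x) <ᴷ (d , u) → St<._<_ e x (lift n p u)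
    <-lift⇐ (x≤u , x≉u) = ≤-lift⇐ x≤u , λ x≈u →
      x≉u (K.Eq.trans {e , x} {e , lift n p u} {d , u} (stage-≈⇒ e x≈u)
             (K.Eq.sym {d , u} {e , lift n p u} (lift-≈ p u)))

  -- A point of `K` below `(d , u)` may be presented in another stage; it is exchanged for an
  -- equivalent point of stage `d`, and accessibility is transported back.
  acc-stage : ∀ {d u} → Acc (St<._<_ d) u → Acc _<ᴷ_ (d , u)
  acc-stage {d} {u} (acc rec) = acc λ {v} v<u →
    let (v′ , v≈v′) = ≤-stage v u (proj₁ v<u)
    in Acc-resp-≈ {_≈_ = K._≈_} (λ {x} {y} → K.Eq.sym {x} {y})
         (λ {x} {y} {z} → <ᴷ-respʳ-≈ {x} {y} {z})
         (K.Eq.sym {v} {d , v′} v≈v′)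
         (acc-stage (rec (<-lift⇐ ≤′-refl u v′ (<ᴷ-respˡ-≈ {d , u} {v} {d , v′} v≈v′ v<u))))

  module _ (em : ExcludedMiddle 0ℓ) where
    private
      module R (d : ℕ) = Regular (stage-regular em n d)

    K-wellFounded : WellFounded _<ᴷ_
    K-wellFounded (d , u) = acc-stage (R.wellFounded d u)

    -- Both points are moved to the stage `d ⊔ e`. Its points are points of `K`, so the agreement of
    -- strict down-sets restricts to it.
    K-separated : Separated (K n) (valK n)
    K-separated (d , u) (e , v) val≡ (f , g) =
      m , p , q , R.separated m (lift n p u) (lift n q v)
        (trans (val-lift n p u) (trans val≡ (sym (val-lift n q v))))
        ( (λ {x} → <-lift⇐ q v x ∘ f {m , x} ∘ <-lift⇒ p u x)
        , (λ {x} → <-lift⇐ p u x ∘ g {m , x} ∘ <-lift⇒ q v x))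
      where
      m = d ℕ.⊔ e
      p = ≤⇒≤′ (m≤m⊔n d e)
      q = ≤⇒≤′ (m≤n⊔m d e)

    K-unduplicated : Unduplicated (K n) (valK n)
    K-unduplicated (d , u) (e , v) (f , g) val≡ =
      R.unduplicated m (lift n p u) (lift n q v)
        ( (λ {x} → ≤-lift⇐ q v x ∘ f {m , x} ∘ <-lift⇒ p u x)
        , (λ {x} → <-lift⇐ p u x ∘ g {m , x} ∘ ≤-lift⇒ q v x))
        (trans (val-lift n p u) (trans val≡ (sym (val-lift n q v))))
      where
      m = d ℕ.⊔ e
      p = ≤⇒≤′ (m≤m⊔n d e)
      q = ≤⇒≤′ (m≤n⊔m d e)

    K-finiteDownSets : FiniteDownSets (K n)
    K-finiteDownSets (d , w) =
      let (us , complete) = R.finite d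
      in map (d ,_) us , λ u u≤w →
        let (u′ , u≈u′) = ≤-stage u w u≤w
        in Anyₚ.map⁺ (Any.map
             (λ {v} u′≈v → K.Eq.trans {u} {d , u′} {d , v} u≈u′ (stage-≈⇒ d u′≈v)) (complete u′))

    principal,coprincipal-generated : ∀ w →
      Generated (F̂ n) (g n) (principal (K n) w) × Generated (F̂ n) (g n) (coprincipal (K n) w)
    principal,coprincipal-generated w = DeJongh.generated em (K n) (valK n)
      (λ {u} {v} → valK-antitone n {u} {v}) K-wellFounded K-separated K-unduplicated K-finiteDownSets
      (K-wellFounded w)

-- Completely irreducible elements of lattices of decreasing sets.

module Irreducibles
  (em : ExcludedMiddle 0ℓ) (P : Poset 0ℓ 0ℓ 0ℓ) (𝓗 : HeytingAlgebra (suc 0ℓ) 0ℓ 0ℓ)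
  -- An order embedding covers both algebras at once: `h` is the identity for `F̂` and the inclusion
  -- for `F`. Joins and meets are those of `𝓗` and depend on its order alone.
  (h : Carrier 𝓗 → DownSet P)
  (h-mono : ∀ {x y} → HeytingAlgebra._≤_ 𝓗 x y → HeytingAlgebra._≤_ (𝒪↓ P) (h x) (h y))
  (h-cancel : ∀ {x y} → HeytingAlgebra._≤_ (𝒪↓ P) (h x) (h y) → HeytingAlgebra._≤_ 𝓗 x y)
  (↓ ∁↑ : Poset.Carrier P → Carrier 𝓗)
  (h-↓ : ∀ w → HeytingAlgebra._≈_ (𝒪↓ P) (h (↓ w)) (principal P w))
  (h-∁↑ : ∀ w → HeytingAlgebra._≈_ (𝒪↓ P) (h (∁↑ w)) (coprincipal P w))
  where

  open Poset P using () renaming (_≤_ to _⊑_; refl to ⊑-refl)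
  open HeytingAlgebra 𝓗 using (reflexive; antisym; module Eq) renaming (_≈_ to _≈ᴴ_)

  h-cong : ∀ {x y} → x ≈ᴴ y → proj₁ (h x) ≐ proj₁ (h y)
  h-cong x≈y = h-mono (reflexive x≈y) , h-mono (reflexive (Eq.sym x≈y))

  joinIrreducible⇔principal : ∀ x →
    CompletelyJoinIrreducible 𝓗 x ⇔ (∃[ w ] proj₁ (h x) ≐ (_⊑ w))
  joinIrreducible⇔principal x = mk⇔ to from
    where
    to : CompletelyJoinIrreducible 𝓗 x → ∃[ w ] proj₁ (h x) ≐ (_⊑ w)
    to irreducible = em⇒dne em λ ∄ → irreducible
      -- All `↓ w` with `w` in `x`: their join is `x`, and none of them equals `x` if `x` is not
      -- principal.
      ( Lift _ (∃ (proj₁ (h x))) , ↓ ∘ proj₁ ∘ lower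
      , (λ (Level.lift (w , _)) ↓w≈x → ∄ (w , ≐-trans (h-cong (Eq.sym ↓w≈x)) (h-↓ w)))
      , (λ (Level.lift (w , w∈x)) → h-cancel λ u∈↓w → proj₂ (h x) (proj₁ (h-↓ w) u∈↓w) w∈x)
      , (λ y ub → h-cancel λ {w} w∈x → h-mono (ub (Level.lift (w , w∈x))) (proj₂ (h-↓ w) ⊑-refl)))

    from : ∃[ w ] proj₁ (h x) ≐ (_⊑ w) → CompletelyJoinIrreducible 𝓗 x
    from (w , x⊆↓w , ↓w⊆x) (I , f , f≉x , f≤x , least) =
      -- A member containing `w` would be all of `x`, so every member misses `w`. Then `∁↑ w` is an
      -- upper bound in `𝓗`, although `x` contains `w`.
      proj₁ (h-∁↑ w) (h-mono (least (∁↑ w) f≤∁↑w) (↓w⊆x ⊑-refl)) ⊑-refl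
      where
      w∉f : ∀ i → ¬ proj₁ (h (f i)) w
      w∉f i w∈f = f≉x i (antisym (f≤x i) (h-cancel λ u∈x → proj₂ (h (f i)) (x⊆↓w u∈x) w∈f))
      f≤∁↑w : ∀ i → HeytingAlgebra._≤_ 𝓗 (f i) (∁↑ w)
      f≤∁↑w i = h-cancel λ u∈f → proj₂ (h-∁↑ w) λ w⊑u → w∉f i (proj₂ (h (f i)) w⊑u u∈f)

  meetIrreducible⇔coprincipal : ∀ x →
    CompletelyMeetIrreducible 𝓗 x ⇔ (∃[ w ] proj₁ (h x) ≐ (λ u → ¬ w ⊑ u))
  meetIrreducible⇔coprincipal x = mk⇔ to from
    where
    to : CompletelyMeetIrreducible 𝓗 x → ∃[ w ] proj₁ (h x) ≐ (λ u → ¬ w ⊑ u)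
    to irreducible = em⇒dne em λ ∄ → irreducible
      ( Lift _ (∃[ w ] ¬ proj₁ (h x) w) , ∁↑ ∘ proj₁ ∘ lower
      , (λ (Level.lift (w , _)) ∁↑w≈x → ∄ (w , ≐-trans (h-cong (Eq.sym ∁↑w≈x)) (h-∁↑ w)))
      , (λ (Level.lift (w , w∉x)) → h-cancel λ u∈x →
          proj₂ (h-∁↑ w) λ w⊑u → w∉x (proj₂ (h x) w⊑u u∈x))
      -- A point `w` of `y` outside `x` would index the member `∁↑ w`, which contains `y` but not
      -- `w`.
      , (λ y lb → h-cancel λ {w} w∈y → em⇒dne em λ w∉x →
          proj₁ (h-∁↑ w) (h-mono (lb (Level.lift (w , w∉x))) w∈y) ⊑-refl))

    from : ∃[ w ] proj₁ (h x) ≐ (λ u → ¬ w ⊑ u) → CompletelyMeetIrreducible 𝓗 x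
    from (w , x⊆∁↑w , ∁↑w⊆x) (I , f , f≉x , x≤f , greatest) =
      -- Dually, a member missing `w` would be contained in `x`, hence equal to it; so `↓ w` is a
      -- lower bound that is not contained in `x`.
      x⊆∁↑w (h-mono (greatest (↓ w) ↓w≤f) (proj₂ (h-↓ w) ⊑-refl)) ⊑-refl
      where
      w∈f : ∀ i → proj₁ (h (f i)) w
      w∈f i = em⇒dne em λ w∉f → f≉x i
        (antisym (h-cancel λ u∈f → ∁↑w⊆x λ w⊑u → w∉f (proj₂ (h (f i)) w⊑u u∈f)) (x≤f i))
      ↓w≤f : ∀ i → HeytingAlgebra._≤_ 𝓗 (↓ w) (f i)
      ↓w≤f i = h-cancel λ u∈↓w → proj₂ (h (f i)) (proj₁ (h-↓ w) u∈↓w) (w∈f i)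

corollary4p2 : ExcludedMiddle (suc 0ℓ) → (n : ℕ) → 1 ≤ n →
    ((∀ (a : Carrier (F̂ n)) → CompletelyJoinIrreducible (F̂ n) a ⇔
    Σ (Generated (F̂ n) (g n) a) (λ p → CompletelyJoinIrreducible (F n) (a , p)))
    × (∀ (a : Carrier (F̂ n)) → CompletelyMeetIrreducible (F̂ n) a ⇔
    Σ (Generated (F̂ n) (g n) a) (λ p → CompletelyMeetIrreducible (F n) (a , p))))
    × (∀ (a : Carrier (F̂ n)) →
    Σ Set (λ I → Σ (I → Carrier (F n)) (λ f → proj₁ a ≐ ⋃ I (proj₁ ∘ proj₁ ∘ f)))
    × Σ Set (λ I → Σ (I → Carrier (F n)) (λ f → proj₁ a ≐ ⋂ I (proj₁ ∘ proj₁ ∘ f))))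
corollary4p2 em₁ n _ = (joins , meets) , λ a → unions a , intersections a
  where
  em : ExcludedMiddle 0ℓ
  em = map′ lower Level.lift em₁

  open Poset (K n) using () renaming (_≤_ to _⊑_; refl to ⊑-refl)
  open Equivalence using (to; from)

  ↓-generated : ∀ w → Generated (F̂ n) (g n) (principal (K n) w)
  ↓-generated w = proj₁ (principal,coprincipal-generated n em w)

  ∁↑-generated : ∀ w → Generated (F̂ n) (g n) (coprincipal (K n) w)
  ∁↑-generated w = proj₂ (principal,coprincipal-generated n em w)

  -- The two instances describe the irreducibles of `F̂` and of `F` by the same decreasing sets, all
  -- of them generated; composing the descriptions gives `joins` and `meets`.
  module Complete = Irreducibles em (K n) (F̂ n) id id id
    (principal (K n)) (coprincipal (K n)) (λ _ → ≐-refl) (λ _ → ≐-refl)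
  module Free = Irreducibles em (K n) (F n) proj₁ id id
    (λ w → principal (K n) w , ↓-generated w) (λ w → coprincipal (K n) w , ∁↑-generated w)
    (λ _ → ≐-refl) (λ _ → ≐-refl)

  joins : ∀ a → CompletelyJoinIrreducible (F̂ n) a ⇔
    Σ (Generated (F̂ n) (g n) a) (λ p → CompletelyJoinIrreducible (F n) (a , p))
  joins a = mk⇔
    (λ irreducible →
      let (w , a≐↓w) = to (Complete.joinIrreducible⇔principal a) irreducible
          p = resp (≐-sym a≐↓w) (↓-generated w)
      in p , from (Free.joinIrreducible⇔principal (a , p)) (w , a≐↓w))
    (λ (p , irreducible) → from (Complete.joinIrreducible⇔principal a)
      (to (Free.joinIrreducible⇔principal (a , p)) irreducible))

  meets : ∀ a → CompletelyMeetIrreducible (F̂ n) a ⇔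
    Σ (Generated (F̂ n) (g n) a) (λ p → CompletelyMeetIrreducible (F n) (a , p))
  meets a = mk⇔
    (λ irreducible →
      let (w , a≐∁↑w) = to (Complete.meetIrreducible⇔coprincipal a) irreducible
          p = resp (≐-sym a≐∁↑w) (∁↑-generated w)
      in p , from (Free.meetIrreducible⇔coprincipal (a , p)) (w , a≐∁↑w))
    (λ (p , irreducible) → from (Complete.meetIrreducible⇔coprincipal a)
      (to (Free.meetIrreducible⇔coprincipal (a , p)) irreducible))

  unions : ∀ a → Σ Set (λ I → Σ (I → Carrier (F n)) (λ f → proj₁ a ≐ ⋃ I (proj₁ ∘ proj₁ ∘ f)))
  unions (A , A↓) =
    ∃ A , (λ (w , _) → principal (K n) w , ↓-generated w) ,
    (λ {w} w∈A → (w , w∈A) , ⊑-refl {w}) , (λ {u} ((w , w∈A) , u⊑w) → A↓ {u} {w} u⊑w w∈A)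

  intersections : ∀ a → Σ Set (λ I → Σ (I → Carrier (F n)) (λ f → proj₁ a ≐ ⋂ I (proj₁ ∘ proj₁ ∘ f)))
  intersections (A , A↓) =
    (∃[ w ] ¬ A w) , (λ (w , _) → coprincipal (K n) w , ∁↑-generated w) ,
    (λ {u} u∈A (w , w∉A) w⊑u → w∉A (A↓ {w} {u} w⊑u u∈A)) ,
    -- A point `u` outside `A` is itself an index, and its member `K ∖ ↑ u` misses `u`.
    (λ {u} u∈⋂ → em⇒dne em λ u∉A → u∈⋂ (u , u∉A) (⊑-refl {u}))
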